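{- In the uncapacitated multi-vehicle Dial-a-Ride problem, an optimal non-preemptive schedule may take $\Omega(\sqrt q)$ times longer than an optimal preemptive schedule: there is an absolute constant $c>0$ such that for every integer $q\ge 2$ there is an instance of uncapacitated multi-vehicle Dial-a-Ride with $q$ vehicles whose optimal non-preemptive makespan is at least $c\sqrt q$ times its optimal preemptive makespan, the latter being positive.
   Context: A finite metric is a pair $(V,d)$ with $d$ a symmetric distance function satisfying the triangle inequality; distances denote travel times. An instance of multi-vehicle Dial-a-Ride consists of a finite metric $(V,d)$, $m$ objects given by source-destination pairs $\{(s_i,t_i)\}_{i=1}^m$, $q$ vehicles with respective depot vertices $r_1,\dots,r_q\in V$ (not necessarily distinct), and a common vehicle capacity $k$. A feasible schedule consists of a route for each vehicle, starting at time $0$, where vehicle $j$ starts and ends at $r_j$, such that no vehicle carries more than $k$ objects at any time and every object is moved from its source to its destination. Vehicles may wait at vertices. In a preemptive schedule an object may be left at any intermediate vertex and later be picked up by the same or another vehicle; in a non-preemptive schedule each object, once picked up at its source, stays in the same vehicle until it is delivered at its destination. The makespan is the maximum over vehicles of the time at which the vehicle returns to its depot at the end of its route. The uncapacitated problem is the special case $k\ge m$.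
   Formalization: Distances and all times in schedules are rational rather than real, so optimal makespans are taken over schedules with rational arrival and departure times; the constant c is rational. -}

module Defs where

open import Data.Nat.Base as ℕ using (ℕ; suc)
import Data.Nat.Properties as ℕ
open import Data.Integer.Base using (+_)
open import Data.Fin.Base using (Fin; zero; suc; toℕ; fromℕ; inject₁)
import Data.Fin.Properties as Fin
open import Data.Rational.Base using (ℚ; 0ℚ; _+_; _*_; _≤_; _/_)
open import Data.Rational.Properties using (≤-decTotalOrder)
open import Data.List.Base using (List; []; _∷_; length; filter; tabulate; allFin)
open import Relation.Binary.Bundles using (module DecTotalOrder)
open import Data.List.Extrema (DecTotalOrder.totalOrder ≤-decTotalOrder) using (max)
open import Data.List.Relation.Unary.Any using (any?)
open import Data.Product.Base using (Σ-syntax; _×_)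
open import Function.Metric.Rational.Core using (DistanceFunction)
open import Function.Metric.Rational.Structures using (IsMetric)
open import Relation.Binary.PropositionalEquality.Core using (_≡_)
open import Relation.Nullary.Decidable.Core using (Dec; _×-dec_)

-- An instance of multi-vehicle Dial-a-Ride with q vehicles.
record Instance (q : ℕ) : Set where
  field
    size     : ℕ
  V : Set
  V = Fin size
  field
    d        : DistanceFunction V
    isMetric : IsMetric _≡_ d
    m        : ℕ
    source   : Fin m → V
    dest     : Fin m → V
    depot    : Fin q → V
    capacity : ℕ

Uncapacitated : ∀ {q} → Instance q → Set
Uncapacitated I = Instance.m I ℕ.≤ Instance.capacity I

module _ {q : ℕ} (I : Instance q) where
  open Instance I

  -- The stops of a vehicle are numbered 0 , … , steps.  The vehicle is at
  -- vertex i throughout the time interval [ arrive i , depart i ], and step i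
  -- is its travel from stop i to stop i + 1.
  record Route (r : V) : Set where
    field
      steps       : ℕ
      vertex      : Fin (suc steps) → V
      arrive      : Fin (suc steps) → ℚ
      depart      : Fin (suc steps) → ℚ
      startsAt    : vertex zero ≡ r
      endsAt      : vertex (fromℕ steps) ≡ r
      startsAt0   : arrive zero ≡ 0ℚ
      waits       : ∀ i → arrive i ≤ depart i
      travels     : ∀ (i : Fin steps) →
                    arrive (suc i) ≡ depart (inject₁ i) + d (vertex (inject₁ i)) (vertex (suc i))

    returnTime : ℚ
    returnTime = arrive (fromℕ steps)

  module _ (route : ∀ j → Route (depot j)) where
    open Route

    -- An uninterrupted ride of one object in one vehicle, from one of the
    -- vehicle's stops to a later one.
    record Ride : Set where
      field
        vehicle : Fin q
        from    : Fin (suc (steps (route vehicle)))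
        to      : Fin (suc (steps (route vehicle)))
        from<to : toℕ from ℕ.< toℕ to

      pickupVertex dropVertex : V
      pickupVertex = vertex (route vehicle) from
      dropVertex   = vertex (route vehicle) to

      -- Loading as late and unloading as early as possible loses no
      -- generality.
      pickupTime dropTime : ℚ
      pickupTime = depart (route vehicle) from
      dropTime   = arrive (route vehicle) to

    open Ride

    -- Itinerary u τ w : the movements of an object that lies at u at time τ
    -- and finally ends up at w.  Between rides the object is left at a vertex.
    data Itinerary : V → ℚ → V → Set where
      done : ∀ {u τ} → Itinerary u τ u
      ride : ∀ {u τ w} (ρ : Ride) → pickupVertex ρ ≡ u → τ ≤ pickupTime ρ →
             Itinerary (dropVertex ρ) (dropTime ρ) w → Itinerary u τ w

    rides : ∀ {u τ w} → Itinerary u τ w → List Ride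
    rides done           = []
    rides (ride ρ _ _ ι) = ρ ∷ rides ι

    OnBoard : (j : Fin q) → Fin (steps (route j)) → Ride → Set
    OnBoard j e ρ = vehicle ρ ≡ j × toℕ (from ρ) ℕ.≤ toℕ e × toℕ e ℕ.< toℕ (to ρ)

    onBoard? : ∀ j e ρ → Dec (OnBoard j e ρ)
    onBoard? j e ρ =
      (vehicle ρ Fin.≟ j) ×-dec (toℕ (from ρ) ℕ.≤? toℕ e) ×-dec (toℕ e ℕ.<? toℕ (to ρ))

    -- The number of objects carried by vehicle j during step e.  An object that
    -- stays in the vehicle while it waits at a stop is also aboard during the
    -- steps before and after, so bounding the load on steps bounds it always.
    load : (∀ i → Itinerary (source i) 0ℚ (dest i)) →
           (j : Fin q) → Fin (steps (route j)) → ℕ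
    load itinerary j e =
      length (filter (λ i → any? (onBoard? j e) (rides (itinerary i))) (allFin m))

  -- Feasible, possibly preemptive, schedules.
  record Schedule : Set where
    field
      route     : ∀ j → Route (depot j)
      itinerary : ∀ i → Itinerary route (source i) 0ℚ (dest i)
      capacity≤ : ∀ j e → load route itinerary j e ℕ.≤ capacity

  -- Return times are nonnegative, so the base value 0 is harmless when 1 ≤ q.
  makespan : Schedule → ℚ
  makespan σ = max 0ℚ (tabulate (λ j → Route.returnTime (Schedule.route σ j)))

  -- An object needs no ride only if its source is its destination.
  NonPreemptive : Schedule → Set
  NonPreemptive σ = ∀ i → length (rides route (itinerary i)) ℕ.≤ 1
    where open Schedule σ

  IsOptimalPreemptiveMakespan : ℚ → Set
  IsOptimalPreemptiveMakespan T =
    (Σ[ σ ∈ Schedule ] makespan σ ≡ T) × (∀ σ → T ≤ makespan σ)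

  IsOptimalNonPreemptiveMakespan : ℚ → Set
  IsOptimalNonPreemptiveMakespan T =
    (Σ[ σ ∈ Schedule ] NonPreemptive σ × makespan σ ≡ T) ×
    (∀ σ → NonPreemptive σ → T ≤ makespan σ)

infix 4 _√_≤_

-- x √n ≤ y for x ≥ 0, with both sides squared because √n need not be rational.
_√_≤_ : ℚ → ℕ → ℚ → Set
x √ n ≤ y = 0ℚ ≤ y × x * x * (+ n / 1) ≤ y * y

{-# OPTIONS --safe #-}

-- Take a star with n² leaves A, n² leaves B, unit edges and n² vehicles at the
-- centre, where n = ⌊√q⌋, and one object for every pair in A × B.  With
-- transfers at the centre each vehicle serves one leaf of A and then one leaf
-- of B, so the preemptive makespan is 4, the length of the trip
-- centre → a → b → centre.  Without transfers a vehicle that visits α leaves of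
-- A and β leaves of B serves at most αβ ≤ ((α + β)/2)² of the n⁴ objects and
-- takes time at least 2(α + β); since some vehicle has αβ ≥ n², the makespan is
-- at least 4n, and this is attained when A and B are cut into n blocks of size n
-- and each vehicle serves one block of A and one of B.  The other q − n²
-- vehicles are based so far away that they cannot reach a leaf and return within
-- time 4n; this makes both optima exact for every q.

module Submission where

open import Defs
open import Data.Nat.Base as ℕ using (ℕ; zero; suc; NonZero; z≤n; s≤s; z<s; s<s)
import Data.Nat.Properties as ℕ
open import Data.Nat.ListAction using (sum)
open import Data.Nat.Tactic.RingSolver using (solve-∀)
open import Data.Nat.Coprimality as Coprime using (1-coprimeTo)
import Data.Integer.Base as ℤ
import Data.Integer.Properties as ℤ
open import Data.Fin.Base
  using (Fin; zero; suc; toℕ; fromℕ; fromℕ<; inject₁; inject≤; splitAt; join; combine; remQuot; _↑ˡ_; _↑ʳ_)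
import Data.Fin.Properties as Fin
open import Data.Fin.Induction using (<-weakInduction)
open import Data.Rational.Base
  using (ℚ; 0ℚ; ½; _<_; _≤_; _+_; _*_; _/_; mkℚ; *≤*; *<*)
open import Data.Rational.Properties
open import Data.Rational.Unnormalised.Base using (*≡*)
import Data.Rational.Unnormalised.Properties as ℚᵘ
open import Data.List.Base using (List; []; _∷_; length; map; concatMap; lookup; allFin; [_])
import Data.List.Properties as List
open import Data.List.Membership.Propositional using (_∈_; lose)
open import Data.List.Membership.Propositional.Properties using (∈-concatMap⁺; ∈-tabulate⁺)
import Data.List.Relation.Unary.All as All
import Data.List.Relation.Unary.All.Properties as All
open import Data.List.Relation.Unary.Any using (here; there; index; tail)
open import Data.List.Relation.Unary.Any.Properties using (lookup-index)
open import Relation.Binary.Bundles using (module DecTotalOrder)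
open import Data.List.Extrema (DecTotalOrder.totalOrder ≤-decTotalOrder) using (max≤v⁺; xs≤max)
open import Data.Product.Base using (Σ-syntax; ∃₂; _×_; _,_; proj₁; proj₂; uncurry)
open import Data.Sum.Base using (_⊎_; inj₁; inj₂; [_,_]′)
open import Function.Base using (_∘_; const; id)
open import Function.Metric.Rational.Core using (DistanceFunction)
open import Function.Metric.Rational.Structures using (IsMetric)
open import Relation.Binary.PropositionalEquality
  using (_≡_; _≢_; refl; sym; trans; cong; cong₂; subst; subst₂; isEquivalence)
open import Relation.Nullary.Decidable.Core using (yes; no)
open import Relation.Nullary.Negation.Core using (contradiction)

-- Natural numbers as rationals

-- Given directly in lowest terms, so that it is a constructor form even for a variable `n` and
-- injectivity holds by matching; `ι≡/1` links it to the form used in `_√_≤_`.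
ι : ℕ → ℚ
ι n = mkℚ (ℤ.+ n) 0 (Coprime.sym (1-coprimeTo n))

ι≡/1 : ∀ n → ι n ≡ ℤ.+ n / 1
ι≡/1 n = sym (fromℚᵘ-toℚᵘ (ι n))

ι-+ : ∀ m n → ι (m ℕ.+ n) ≡ ι m + ι n
ι-+ m n = toℚᵘ-injective (ℚᵘ.≃-trans
  (*≡* (cong (ℤ._* ℤ.+ 1) (sym (cong₂ ℤ._+_ (ℤ.*-identityʳ (ℤ.+ m)) (ℤ.*-identityʳ (ℤ.+ n))))))
  (ℚᵘ.≃-sym (toℚᵘ-homo-+ (ι m) (ι n))))

ι-* : ∀ m n → ι (m ℕ.* n) ≡ ι m * ι n
ι-* m n = toℚᵘ-injective (ℚᵘ.≃-trans
  (*≡* (cong (ℤ._* ℤ.+ 1) (ℤ.pos-* m n)))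
  (ℚᵘ.≃-sym (toℚᵘ-homo-* (ι m) (ι n))))

ι-mono-≤ : ∀ {m n} → m ℕ.≤ n → ι m ≤ ι n
ι-mono-≤ m≤n = *≤* (ℤ.*-monoʳ-≤-nonNeg (ℤ.+ 1) (ℤ.+≤+ m≤n))

ι-injective : ∀ {m n} → ι m ≡ ι n → m ≡ n
ι-injective refl = refl

-- Arithmetic of squares

-- If a + b < 2n, then (a + b)² < 4n² ≤ 4ab, against 4ab + (b - a)² = (a + b)². This converts the
-- area of a rectangle of served pairs into a number of leaves to visit.
am-gm : ∀ n a b → n ℕ.* n ℕ.≤ a ℕ.* b → n ℕ.+ n ℕ.≤ a ℕ.+ b
am-gm n a b n²≤ab = ℕ.≮⇒≥ λ a+b<2n → ℕ.<⇒≱ (ℕ.*-mono-< a+b<2n a+b<2n) (begin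
  (n ℕ.+ n) ℕ.* (n ℕ.+ n)         ≡⟨ square n ⟩
  4 ℕ.* (n ℕ.* n)                 ≤⟨ ℕ.*-monoʳ-≤ 4 n²≤ab ⟩
  4 ℕ.* (a ℕ.* b)                 ≤⟨ four (ℕ.≤-total a b) ⟩
  (a ℕ.+ b) ℕ.* (a ℕ.+ b)         ∎)
  where
  open ℕ.≤-Reasoning
  square : ∀ n → (n ℕ.+ n) ℕ.* (n ℕ.+ n) ≡ 4 ℕ.* (n ℕ.* n)
  square = solve-∀
  split : ∀ a t → 4 ℕ.* (a ℕ.* (a ℕ.+ t)) ℕ.+ t ℕ.* t ≡ (a ℕ.+ (a ℕ.+ t)) ℕ.* (a ℕ.+ (a ℕ.+ t))
  split = solve-∀
  four≤ : ∀ {a b} → a ℕ.≤ b → 4 ℕ.* (a ℕ.* b) ℕ.≤ (a ℕ.+ b) ℕ.* (a ℕ.+ b)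
  four≤ {a} a≤b with t , refl ← ℕ.m≤n⇒∃[o]m+o≡n a≤b = ℕ.≤-trans (ℕ.m≤m+n _ (t ℕ.* t)) (ℕ.≤-reflexive (split a t))
  four : a ℕ.≤ b ⊎ b ℕ.≤ a → 4 ℕ.* (a ℕ.* b) ℕ.≤ (a ℕ.+ b) ℕ.* (a ℕ.+ b)
  four (inj₁ a≤b) = four≤ a≤b
  four (inj₂ b≤a) = subst₂ (λ x y → 4 ℕ.* x ℕ.≤ y ℕ.* y) (ℕ.*-comm b a) (ℕ.+-comm b a) (four≤ b≤a)

floor-√ : ∀ q → Σ[ n ∈ ℕ ] n ℕ.* n ℕ.≤ q × q ℕ.< suc n ℕ.* suc n
floor-√ zero = 0 , z≤n , z<s
floor-√ (suc q) with n , n²≤q , q<[1+n]² ← floor-√ q with suc q ℕ.<? suc n ℕ.* suc n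
... | yes 1+q<[1+n]² = n , ℕ.m≤n⇒m≤1+n n²≤q , 1+q<[1+n]²
... | no  1+q≮[1+n]² = suc n , ℕ.≮⇒≥ 1+q≮[1+n]² ,
  ℕ.≤-<-trans q<[1+n]² (ℕ.*-mono-< (ℕ.n<1+n (suc n)) (ℕ.n<1+n (suc n)))

-- Covering a square grid by rectangles

-- Encode a cell by a rectangle that contains it and its position there, one of at most M. The code
-- determines the cell, so fewer than k² codes would contradict the pigeonhole principle.
rectangles-cover : ∀ {v k} M (X Y : Fin v → List (Fin k)) →
  (∀ j → length (X j) ℕ.* length (Y j) ℕ.≤ M) →
  (∀ a b → Σ[ j ∈ Fin v ] a ∈ X j × b ∈ Y j) →
  k ℕ.* k ℕ.≤ v ℕ.* M
rectangles-cover {v} {k} M X Y area≤M cover = ℕ.≮⇒≥ λ vM<k² →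
  let o , o′ , o<o′ , eq = Fin.pigeonhole vM<k² (uncurry code ∘ remQuot k)
  in Fin.<⇒≢ o<o′ (trans (sym (Fin.combine-remQuot {k} k o))
       (trans (uncurry (cong₂ combine) (code-injective _ _ _ _ eq)) (Fin.combine-remQuot {k} k o′)))
  where
  position : ∀ {a b} j → a ∈ X j → b ∈ Y j → Fin M
  position j a∈ b∈ = inject≤ (combine (index a∈) (index b∈)) (area≤M j)

  -- Stated for arbitrary indices so that `j ≡ j′` can be matched; in `code-injective` both are
  -- components of `cover`. Lists may repeat entries: a position is that of the chosen membership
  -- proof, and lookup there recovers the entry.
  position-injective : ∀ {a b a′ b′} j j′
    (a∈ : a ∈ X j) (b∈ : b ∈ Y j) (a′∈ : a′ ∈ X j′) (b′∈ : b′ ∈ Y j′) →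
    j ≡ j′ → position j a∈ b∈ ≡ position j′ a′∈ b′∈ → a ≡ a′ × b ≡ b′
  position-injective j .j a∈ b∈ a′∈ b′∈ refl eq =
    let i≡ , k≡ = Fin.combine-injective (index a∈) (index b∈) (index a′∈) (index b′∈)
                    (Fin.inject≤-injective (area≤M j) (area≤M j) _ _ eq)
    in trans (lookup-index a∈) (trans (cong (lookup (X j)) i≡) (sym (lookup-index a′∈))) ,
       trans (lookup-index b∈) (trans (cong (lookup (Y j)) k≡) (sym (lookup-index b′∈)))

  code : Fin k → Fin k → Fin (v ℕ.* M)
  code a b = let j , a∈ , b∈ = cover a b in combine j (position j a∈ b∈)

  code-injective : ∀ a b a′ b′ → code a b ≡ code a′ b′ → a ≡ a′ × b ≡ b′
  code-injective a b a′ b′ eq =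
    let j  , a∈  , b∈  = cover a b
        j′ , a′∈ , b′∈ = cover a′ b′
    in uncurry (position-injective j j′ a∈ b∈ a′∈ b′∈) (Fin.combine-injective j _ j′ _ eq)

-- Lower bounds on travel times

module _ {q : ℕ} (I : Instance q) where
  open Instance I
  open IsMetric isMetric using (triangle; ≈⇒0; nonNegative)

  module _ {r : V} (R : Route I r) where
    open Route R

    -- Induction on the later stop, with the triangle inequality through the stop just before it.
    elapsed : ∀ j i → toℕ i ℕ.< toℕ j → depart i + d (vertex i) (vertex j) ≤ arrive j
    elapsed = <-weakInduction _ (λ _ ()) step
      where
      step : ∀ j → (∀ i → toℕ i ℕ.< toℕ (inject₁ j) →
                          depart i + d (vertex i) (vertex (inject₁ j)) ≤ arrive (inject₁ j)) →
             ∀ i → toℕ i ℕ.< suc (toℕ j) → depart i + d (vertex i) (vertex (suc j)) ≤ arrive (suc j)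
      step j ih i (s≤s i≤j) with ℕ.m≤n⇒m<n∨m≡n (subst (toℕ i ℕ.≤_) (sym (Fin.toℕ-inject₁ j)) i≤j)
      ... | inj₂ i≡j rewrite Fin.toℕ-injective i≡j = ≤-reflexive (sym (travels j))
      ... | inj₁ i<j = begin
        depart i + d (vertex i) (vertex (suc j))
          ≤⟨ +-monoʳ-≤ (depart i) (triangle _ _ _) ⟩
        depart i + (d (vertex i) (vertex (inject₁ j)) + d (vertex (inject₁ j)) (vertex (suc j)))
          ≡⟨ +-assoc (depart i) _ _ ⟨
        depart i + d (vertex i) (vertex (inject₁ j)) + d (vertex (inject₁ j)) (vertex (suc j))
          ≤⟨ +-monoˡ-≤ _ (≤-trans (ih i i<j) (waits (inject₁ j))) ⟩
        depart (inject₁ j) + d (vertex (inject₁ j)) (vertex (suc j))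
          ≡⟨ travels j ⟨
        arrive (suc j) ∎
        where open ≤-Reasoning

    d[depot,v]≤arrive : ∀ i → d r (vertex i) ≤ arrive i
    d[depot,v]≤arrive zero =
      ≤-reflexive (trans (≈⇒0 (sym startsAt)) (sym startsAt0))
    d[depot,v]≤arrive (suc i) = begin
      d r (vertex (suc i))                          ≡⟨ cong (λ x → d x (vertex (suc i))) startsAt ⟨
      d (vertex zero) (vertex (suc i))              ≡⟨ +-identityˡ _ ⟨
      0ℚ + d (vertex zero) (vertex (suc i))         ≤⟨ +-monoˡ-≤ _ (≤-trans (≤-reflexive (sym startsAt0)) (waits zero)) ⟩
      depart zero + d (vertex zero) (vertex (suc i)) ≤⟨ elapsed (suc i) zero z<s ⟩
      arrive (suc i)                                ∎
      where open ≤-Reasoning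

    arrive+d[v,depot]≤returnTime : ∀ i → arrive i + d (vertex i) r ≤ returnTime
    arrive+d[v,depot]≤returnTime i with ℕ.m≤n⇒m<n∨m≡n (ℕ.≤-pred (Fin.toℕ<n i))
    ... | inj₁ i<end = begin
      arrive i + d (vertex i) r                      ≡⟨ cong (λ x → arrive i + d (vertex i) x) endsAt ⟨
      arrive i + d (vertex i) (vertex (fromℕ steps)) ≤⟨ +-monoˡ-≤ _ (waits i) ⟩
      depart i + d (vertex i) (vertex (fromℕ steps)) ≤⟨ elapsed (fromℕ steps) i (subst (toℕ i ℕ.<_) (sym (Fin.toℕ-fromℕ steps)) i<end) ⟩
      returnTime                                     ∎
      where open ≤-Reasoning
    ... | inj₂ i≡end with refl ← Fin.toℕ-injective {i = i} {j = fromℕ steps} (trans i≡end (sym (Fin.toℕ-fromℕ steps))) =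
      ≤-reflexive (trans (cong (returnTime +_) (≈⇒0 endsAt)) (+-identityʳ returnTime))

    -- Each vertex x is paid for on entering and on leaving; adding the weight of
    -- the current vertex to the elapsed time charges both payments on arrival.
    visited : (w : V → ℕ) → (∀ {x y} → x ≢ y → ι (w x ℕ.+ w y) ≤ d x y) →
      Σ[ L ∈ List V ] (∀ i → vertex i ∈ r ∷ L) × ι (sum (map w L) ℕ.* 2) ≤ returnTime + ι (w r)
    visited w w≤d =
      let L , v∈L , bound = <-weakInduction P base step (fromℕ steps)
      in L ,
         (λ i → v∈L i (subst (toℕ i ℕ.≤_) (sym (Fin.toℕ-fromℕ steps)) (ℕ.≤-pred (Fin.toℕ<n i)))) ,
         subst (λ x → ι (sum (map w L) ℕ.* 2) ≤ returnTime + ι (w x)) endsAt bound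
      where
      P : Fin (suc steps) → Set
      P k = Σ[ L ∈ List V ] (∀ i → toℕ i ℕ.≤ toℕ k → vertex i ∈ r ∷ L) ×
                            ι (sum (map w L) ℕ.* 2) ≤ arrive k + ι (w (vertex k))

      base : P zero
      base = [] , (λ { zero _ → here startsAt }) ,
        +-mono-≤ (≤-reflexive (sym startsAt0)) (ι-mono-≤ z≤n)

      old : ∀ {L} j → (∀ i → toℕ i ℕ.≤ toℕ (inject₁ j) → vertex i ∈ L) →
            ∀ i → toℕ i ℕ.≤ suc (toℕ j) → vertex i ∈ L ⊎ i ≡ suc j
      old j v∈L i i≤ with ℕ.m≤n⇒m<n∨m≡n i≤
      ... | inj₁ (s≤s i≤j) = inj₁ (v∈L i (subst (toℕ i ℕ.≤_) (sym (Fin.toℕ-inject₁ j)) i≤j))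
      ... | inj₂ i≡        = inj₂ (Fin.toℕ-injective i≡)

      step : ∀ j → P (inject₁ j) → P (suc j)
      step j (L , v∈L , bound) with vertex (inject₁ j) Fin.≟ vertex (suc j)
      -- Staying at a vertex is not covered by `w≤d`, and no new vertex has to be paid for.
      ... | yes same = L , vs , (begin
        ι (sum (map w L) ℕ.* 2)                        ≤⟨ bound ⟩
        arrive (inject₁ j) + ι (w (vertex (inject₁ j))) ≡⟨ cong₂ _+_ (sym (+-identityʳ (arrive (inject₁ j)))) (cong (ι ∘ w) same) ⟩
        arrive (inject₁ j) + 0ℚ + ι (w (vertex (suc j))) ≤⟨ +-monoˡ-≤ _ (+-mono-≤ (waits (inject₁ j)) nonNegative) ⟩
        depart (inject₁ j) + d (vertex (inject₁ j)) (vertex (suc j)) + ι (w (vertex (suc j)))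
          ≡⟨ cong (_+ ι (w (vertex (suc j)))) (travels j) ⟨
        arrive (suc j) + ι (w (vertex (suc j)))        ∎)
        where
        open ≤-Reasoning
        vs : ∀ i → toℕ i ℕ.≤ suc (toℕ j) → vertex i ∈ r ∷ L
        vs i i≤ with old j v∈L i i≤
        ... | inj₁ v∈ = v∈
        ... | inj₂ refl = subst (_∈ r ∷ L) same (v∈L (inject₁ j) ℕ.≤-refl)
      -- The travel pays w y + w x and the added weight changes from w y to w x, so the right side
      -- grows by at least 2 w x, the price of the new entry.
      ... | no differ = x ∷ L , vs , (begin
        ι ((w x ℕ.+ sum (map w L)) ℕ.* 2)              ≡⟨ cong ι (rearrange (w x) (sum (map w L))) ⟩
        ι (sum (map w L) ℕ.* 2 ℕ.+ w x ℕ.+ w x)        ≡⟨ trans (ι-+ (sum (map w L) ℕ.* 2 ℕ.+ w x) (w x)) (cong (_+ ι (w x)) (ι-+ (sum (map w L) ℕ.* 2) (w x))) ⟩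
        ι (sum (map w L) ℕ.* 2) + ι (w x) + ι (w x)    ≤⟨ +-monoˡ-≤ _ (+-monoˡ-≤ _ bound) ⟩
        arrive (inject₁ j) + ι (w y) + ι (w x) + ι (w x) ≡⟨ cong (_+ ι (w x)) (trans (+-assoc (arrive (inject₁ j)) (ι (w y)) (ι (w x))) (cong (arrive (inject₁ j) +_) (sym (ι-+ (w y) (w x))))) ⟩
        arrive (inject₁ j) + ι (w y ℕ.+ w x) + ι (w x) ≤⟨ +-monoˡ-≤ _ (+-mono-≤ (waits (inject₁ j)) (w≤d differ)) ⟩
        depart (inject₁ j) + d y x + ι (w x)           ≡⟨ cong (_+ ι (w x)) (travels j) ⟨
        arrive (suc j) + ι (w x)                       ∎)
        where
        open ≤-Reasoning
        x y : V
        x = vertex (suc j)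
        y = vertex (inject₁ j)
        rearrange : ∀ a b → (a ℕ.+ b) ℕ.* 2 ≡ b ℕ.* 2 ℕ.+ a ℕ.+ a
        rearrange = solve-∀
        vs : ∀ i → toℕ i ℕ.≤ suc (toℕ j) → vertex i ∈ r ∷ x ∷ L
        vs i i≤ with old j v∈L i i≤
        ... | inj₁ (here eq)  = here eq
        ... | inj₁ (there v∈) = there (there v∈)
        ... | inj₂ refl       = there (here refl)

  module _ (route : ∀ j → Route I (depot j)) where
    open Ride
    open Route

    pickupTime+d≤dropTime : (ρ : Ride I route) →
      pickupTime ρ + d (pickupVertex ρ) (dropVertex ρ) ≤ dropTime ρ
    pickupTime+d≤dropTime ρ = elapsed (route (vehicle ρ)) (to ρ) (from ρ) (from<to ρ)

    -- Every ride takes at least the distance between its ends and none starts before the previous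
    -- one is over, so the triangle inequality bounds the time of the final drop.
    lastRide : ∀ {u τ w} → Itinerary I route u τ w →
      u ≡ w ⊎ Σ[ ρ ∈ Ride I route ] dropVertex ρ ≡ w × τ + d u w ≤ dropTime ρ
    lastRide done = inj₁ refl
    lastRide {u} {τ} {w} (ride ρ refl τ≤ κ) with lastRide κ
    ... | inj₁ refl = inj₂ (ρ , refl , ≤-trans (+-monoˡ-≤ _ τ≤) (pickupTime+d≤dropTime ρ))
    ... | inj₂ (ρ′ , at-w , bound) = inj₂ (ρ′ , at-w , (begin
      τ + d u w                                  ≤⟨ +-monoʳ-≤ τ (triangle _ _ _) ⟩
      τ + (d u (dropVertex ρ) + d (dropVertex ρ) w) ≡⟨ +-assoc τ _ _ ⟨
      τ + d u (dropVertex ρ) + d (dropVertex ρ) w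
        ≤⟨ +-monoˡ-≤ _ (≤-trans (+-monoˡ-≤ _ τ≤) (pickupTime+d≤dropTime ρ)) ⟩
      dropTime ρ + d (dropVertex ρ) w            ≤⟨ bound ⟩
      dropTime ρ′                                ∎))
      where open ≤-Reasoning

  returnTime≤makespan : ∀ σ j → Route.returnTime (Schedule.route σ j) ≤ makespan I σ
  returnTime≤makespan σ j = All.lookup (xs≤max 0ℚ _) (∈-tabulate⁺ j)

  makespan≤ : ∀ σ {T} → 0ℚ ≤ T → (∀ j → Route.returnTime (Schedule.route σ j) ≤ T) → makespan I σ ≤ T
  makespan≤ σ 0≤T returns≤T = max≤v⁺ 0≤T (All.tabulate⁺ returns≤T)

  -- An object starts to move only after some vehicle has come from its depot, and
  -- the vehicle that delivers it must still return.
  d[depot,s]+d[s,t]+d[t,depot]≤makespan : ∀ σ i → source i ≢ dest i →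
    ∃₂ λ j k → d (depot j) (source i) + d (source i) (dest i) + d (dest i) (depot k) ≤ makespan I σ
  d[depot,s]+d[s,t]+d[t,depot]≤makespan σ i = go (Schedule.itinerary σ i)
    where
    open Schedule σ
    open Ride
    open ≤-Reasoning
    go : ∀ {u τ w} → Itinerary I route u τ w → u ≢ w →
      ∃₂ λ j k → d (depot j) u + d u w + d w (depot k) ≤ makespan I σ
    go done u≢w = contradiction refl u≢w
    -- The itinerary is restarted at the pickup time of its first ride, so that the bound also
    -- counts the way of that vehicle from its depot.
    go {u} {_} {w} (ride ρ refl τ≤ κ) u≢w with lastRide route (ride ρ refl ≤-refl κ)
    ... | inj₁ u≡w = contradiction u≡w u≢w
    ... | inj₂ (ρ′ , at-w , bound) = vehicle ρ , vehicle ρ′ , (begin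
      d (depot (vehicle ρ)) u + d u w + d w (depot (vehicle ρ′))
        ≤⟨ +-monoˡ-≤ _ (+-monoˡ-≤ _ (≤-trans (d[depot,v]≤arrive (route (vehicle ρ)) (from ρ))
                                             (Route.waits (route (vehicle ρ)) (from ρ)))) ⟩
      pickupTime ρ + d u w + d w (depot (vehicle ρ′))
        ≤⟨ +-monoˡ-≤ _ bound ⟩
      dropTime ρ′ + d w (depot (vehicle ρ′))
        ≡⟨ cong (λ x → dropTime ρ′ + d x (depot (vehicle ρ′))) at-w ⟨
      dropTime ρ′ + d (dropVertex ρ′) (depot (vehicle ρ′))
        ≤⟨ arrive+d[v,depot]≤returnTime (route (vehicle ρ′)) (to ρ′) ⟩
      Route.returnTime (route (vehicle ρ′))
        ≤⟨ returnTime≤makespan σ (vehicle ρ′) ⟩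
      makespan I σ ∎)

-- The star metric: all travel passes through a centre, at distance w x from x.

module Star {s : ℕ} (w : Fin s → ℕ) (w-positive : ∀ {x y} → w x ℕ.+ w y ≡ 0 → x ≡ y) where

  dist : Fin s → Fin s → ℕ
  dist x y with x Fin.≟ y
  ... | yes _ = 0
  ... | no  _ = w x ℕ.+ w y

  dist-refl : ∀ x → dist x x ≡ 0
  dist-refl x with x Fin.≟ x
  ... | yes _   = refl
  ... | no  x≢x = contradiction refl x≢x

  dist-≢ : ∀ {x y} → x ≢ y → dist x y ≡ w x ℕ.+ w y
  dist-≢ {x} {y} x≢y with x Fin.≟ y
  ... | yes x≡y = contradiction x≡y x≢y
  ... | no  _   = refl

  dist-sym : ∀ x y → dist x y ≡ dist y x
  dist-sym x y with x Fin.≟ y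
  ... | yes refl = sym (dist-refl x)
  ... | no  x≢y  = trans (ℕ.+-comm (w x) (w y)) (sym (dist-≢ (x≢y ∘ sym)))

  dist-0⇒≡ : ∀ {x y} → dist x y ≡ 0 → x ≡ y
  dist-0⇒≡ {x} {y} eq with x Fin.≟ y
  ... | yes x≡y = x≡y
  ... | no  _   = w-positive eq

  dist-triangle : ∀ x y z → dist x z ℕ.≤ dist x y ℕ.+ dist y z
  dist-triangle x y z with x Fin.≟ z
  ... | yes _ = z≤n
  ... | no x≢z with x Fin.≟ y | y Fin.≟ z
  ...   | yes refl | yes refl = contradiction refl x≢z
  ...   | yes refl | no _     = ℕ.≤-refl
  ...   | no _     | yes refl = ℕ.m≤m+n _ 0
  ...   | no _     | no _     = ℕ.+-mono-≤ (ℕ.m≤m+n (w x) (w y)) (ℕ.m≤n+m (w z) (w y))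

  d : DistanceFunction (Fin s)
  d x y = ι (dist x y)

  isMetric : IsMetric _≡_ d
  isMetric = record
    { isSemiMetric = record
      { isQuasiSemiMetric = record
        { isPreMetric = record
          { isProtoMetric = record
            { isPartialOrder  = ≤-isPartialOrder
            ; ≈-isEquivalence = isEquivalence
            ; cong            = cong₂ d
            ; nonNegative     = ι-mono-≤ z≤n
            }
          ; ≈⇒0 = λ { {x} refl → cong ι (dist-refl x) }
          }
        ; 0⇒≈ = λ eq → dist-0⇒≡ (ι-injective {n = 0} eq)
        }
      ; sym = λ x y → cong ι (dist-sym x y)
      }
    ; triangle = λ x y z → ≤-trans (ι-mono-≤ (dist-triangle x y z)) (≤-reflexive (ι-+ (dist x y) (dist y z)))
    }

-- The star instance with n² + r vehicles

module Gap (n r : ℕ) .{{_ : NonZero n}} where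

  K : ℕ
  K = n ℕ.* n

  instance
    K-nonZero : NonZero K
    K-nonZero = ℕ.m*n≢0 n n

  -- Vertex 0 is the centre and vertex 1 the remote base of the surplus vehicles.
  weight : Fin (2 ℕ.+ (K ℕ.+ K)) → ℕ
  weight zero          = 0
  -- A round trip from here to a leaf takes 2(2n + 2), more than 4n.
  weight (suc zero)    = suc (n ℕ.+ n)
  weight (suc (suc _)) = 1

  weight-positive : ∀ {x y} → weight x ℕ.+ weight y ≡ 0 → x ≡ y
  weight-positive {zero} {zero}        _ = refl
  weight-positive {zero} {suc zero}    ()
  weight-positive {zero} {suc (suc _)} ()
  weight-positive {suc zero}           ()
  weight-positive {suc (suc _)}        ()

  module S = Star weight weight-positive

  leaf : Fin K ⊎ Fin K → Fin (2 ℕ.+ (K ℕ.+ K))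
  leaf s = suc (suc (join K K s))

  leaf-injective : ∀ {s t} → leaf s ≡ leaf t → s ≡ t
  leaf-injective {s} {t} eq = trans (sym (Fin.splitAt-join K K s))
    (trans (cong (splitAt K) (Fin.suc-injective (Fin.suc-injective eq))) (Fin.splitAt-join K K t))

  base : Fin K ⊎ Fin r → Fin (2 ℕ.+ (K ℕ.+ K))
  base (inj₁ _) = zero
  base (inj₂ _) = suc zero

  base≢leaf : ∀ s t → base s ≢ leaf t
  base≢leaf (inj₁ _) _ ()
  base≢leaf (inj₂ _) _ ()

  star : Instance (K ℕ.+ r)
  star = record
    { size     = 2 ℕ.+ (K ℕ.+ K)
    ; d        = S.d
    ; isMetric = S.isMetric
    ; m        = K ℕ.* K
    ; source   = λ o → leaf (inj₁ (proj₁ (remQuot {K} K o)))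
    ; dest     = λ o → leaf (inj₂ (proj₂ (remQuot {K} K o)))
    ; depot    = λ j → base (splitAt K j)
    ; capacity = K ℕ.* K
    }

  open Instance star using (V; source; dest; depot)

  source≢dest : ∀ o → source o ≢ dest o
  source≢dest o eq with () ← leaf-injective {inj₁ _} {inj₂ _} eq

  -- Shuttling between the centre and the leaves

  -- Even stops are at the centre and stop 2l + 1 is at the leaf `f l`. The length `L * 2` unfolds
  -- by two for each leaf, in step with the recursion.
  tour : ∀ L → (Fin L → Fin K ⊎ Fin K) → Fin (suc (L ℕ.* 2)) → V
  tour L       f zero          = zero
  tour (suc L) f (suc zero)    = leaf (f zero)
  tour (suc L) f (suc (suc i)) = tour L (f ∘ suc) i

  tour-unit-steps : ∀ L f i → S.dist (tour L f (inject₁ i)) (tour L f (suc i)) ≡ 1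
  tour-unit-steps (suc L) f zero          = refl
  tour-unit-steps (suc L) f (suc zero)    = refl
  tour-unit-steps (suc L) f (suc (suc i)) = tour-unit-steps L (f ∘ suc) i

  tour-returns : ∀ L f → tour L f (fromℕ (L ℕ.* 2)) ≡ zero
  tour-returns zero    f = refl
  tour-returns (suc L) f = tour-returns L (f ∘ suc)

  stop : ∀ {L} → Fin L → Fin (suc (L ℕ.* 2))
  stop zero    = suc zero
  stop (suc l) = suc (suc (stop l))

  tour-stop : ∀ L f l → tour L f (stop l) ≡ leaf (f l)
  tour-stop (suc L) f zero    = refl
  tour-stop (suc L) f (suc l) = tour-stop L (f ∘ suc) l

  stop-mono-< : ∀ {L} {i j : Fin L} → toℕ i ℕ.< toℕ j → toℕ (stop i) ℕ.< toℕ (stop j)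
  stop-mono-< {i = zero}  {suc j} _         = s<s z<s
  stop-mono-< {i = suc i} {suc j} (s≤s i<j) = s<s (s<s (stop-mono-< i<j))

  -- All steps have length 1 and there is no waiting, so the time equals the number of the stop.
  shuttle : ∀ L → (Fin L → Fin K ⊎ Fin K) → Route star zero
  shuttle L f = record
    { steps     = L ℕ.* 2
    ; vertex    = tour L f
    ; arrive    = ι ∘ toℕ
    ; depart    = ι ∘ toℕ
    ; startsAt  = refl
    ; endsAt    = tour-returns L f
    ; startsAt0 = refl
    ; waits     = λ _ → ≤-refl
    ; travels   = λ i → trans (cong ι (trans (ℕ.+-comm 1 (toℕ i))
        (sym (cong₂ ℕ._+_ (Fin.toℕ-inject₁ i) (tour-unit-steps L f i)))))
        (ι-+ (toℕ (inject₁ i)) _)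
    }

  idle : ∀ v → Route star v
  idle v = record
    { steps     = 0
    ; vertex    = λ _ → v
    ; arrive    = λ _ → 0ℚ
    ; depart    = λ _ → 0ℚ
    ; startsAt  = refl
    ; endsAt    = refl
    ; startsAt0 = refl
    ; waits     = λ _ → ≤-refl
    ; travels   = λ ()
    }

  module Shuttles (L : ℕ) (stops : Fin K → Fin L → Fin K ⊎ Fin K) where

    routeOf : ∀ s → Route star (base s)
    routeOf (inj₁ v) = shuttle L (stops v)
    routeOf (inj₂ _) = idle (suc zero)

    route : ∀ j → Route star (depot j)
    route j = routeOf (splitAt K j)

    open Route

    -- The route of `j` does not reduce until `splitAt K j` is known. With its value as a variable
    -- `s`, stops can be given on `routeOf s` and the equation matched afterwards.
    hopOf : ∀ {u τ w} j s → splitAt K j ≡ s → (i k : Fin (suc (steps (routeOf s)))) →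
      toℕ i ℕ.< toℕ k → vertex (routeOf s) i ≡ u → τ ≤ depart (routeOf s) i →
      (κ : Itinerary star route (vertex (routeOf s) k) (arrive (routeOf s) k) w) →
      Σ[ κ′ ∈ Itinerary star route u τ w ]
        length (rides star route κ′) ≡ suc (length (rides star route κ))
    hopOf j .(splitAt K j) refl i k i<k at-u τ≤ κ =
      ride (record { vehicle = j ; from = i ; to = k ; from<to = i<k }) at-u τ≤ κ , refl

    hop : ∀ {u τ w} v (i k : Fin (suc (L ℕ.* 2))) → toℕ i ℕ.< toℕ k →
      tour L (stops v) i ≡ u → τ ≤ ι (toℕ i) →
      (κ : Itinerary star route (tour L (stops v) k) (ι (toℕ k)) w) →
      Σ[ κ′ ∈ Itinerary star route u τ w ]
        length (rides star route κ′) ≡ suc (length (rides star route κ))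
    hop v = hopOf (v ↑ˡ r) (inj₁ v) (Fin.splitAt-↑ˡ K v r)

    module _ (itinerary : ∀ o → Itinerary star route (source o) 0ℚ (dest o)) where

      schedule : Schedule star
      schedule = record
        { route     = route
        ; itinerary = itinerary
        ; capacity≤ = λ j e → ℕ.≤-trans (List.length-filter _ (allFin (K ℕ.* K)))
                                        (ℕ.≤-reflexive (List.length-tabulate id))
        }

      makespan-schedule : makespan star schedule ≤ ι (L ℕ.* 2)
      makespan-schedule = makespan≤ star schedule (ι-mono-≤ z≤n) (λ j → returns (splitAt K j))
        where
        returns : ∀ s → returnTime (routeOf s) ≤ ι (L ℕ.* 2)
        returns (inj₁ v) = ≤-reflexive (cong ι (Fin.toℕ-fromℕ (L ℕ.* 2)))
        returns (inj₂ _) = ι-mono-≤ z≤n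

  -- The preemptive optimum

  preemptive-optimum : IsOptimalPreemptiveMakespan star (ι 4)
  preemptive-optimum =
    (schedule itinerary , ≤-antisym (makespan-schedule itinerary) (bound (schedule itinerary))) , bound
    where
    stops : Fin K → Fin 2 → Fin K ⊎ Fin K
    stops v zero       = inj₁ v
    stops v (suc zero) = inj₂ v

    open Shuttles 2 stops

    1≤d[depot,leaf] : ∀ j t → ι 1 ≤ S.d (depot j) (leaf t)
    1≤d[depot,leaf] j t = ι-mono-≤ (subst (1 ℕ.≤_) (sym (S.dist-≢ (base≢leaf (splitAt K j) t)))
                                          (ℕ.m≤n+m 1 (weight (depot j))))

    itinerary : ∀ o → Itinerary star route (source o) 0ℚ (dest o)
    itinerary o =
      let a , b = remQuot {K} K o
      -- Vehicle a brings the object to the centre at time 2; vehicle b is at the centre at that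
      -- moment and leaves for leaf b.
      in hop a (suc zero) (suc (suc zero)) (s<s z<s) refl (ι-mono-≤ z≤n)
           (hop b (suc (suc zero)) (suc (suc (suc zero))) (s<s (s<s z<s)) refl ≤-refl done .proj₁) .proj₁

    -- A single object, which exists since n is nonzero, forces 1 + 2 + 1: from a depot to its
    -- source, on to its destination, and back to a depot.
    bound : ∀ σ → ι 4 ≤ makespan star σ
    bound σ =
      let o = fromℕ< (ℕ.>-nonZero⁻¹ (K ℕ.* K) {{ℕ.m*n≢0 K K}})
          a , b = remQuot {K} K o
          j , k , d≤makespan = d[depot,s]+d[s,t]+d[t,depot]≤makespan star σ o (source≢dest o)
      in ≤-trans (+-mono-≤ (+-mono-≤ (1≤d[depot,leaf] j (inj₁ a))
                                     (≤-reflexive (cong ι (sym (S.dist-≢ (source≢dest o))))))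
                           (≤-trans (1≤d[depot,leaf] k (inj₂ b))
                                    (≤-reflexive (cong ι (S.dist-sym (depot k) (dest o))))))
                 d≤makespan

  -- Non-preemptive schedules

  -- At most one entry for each vertex, so that `concatMap` extracts from the vertices of a route
  -- the two sides of its rectangle.
  A-leaves B-leaves : V → List (Fin K)
  A-leaves zero          = []
  A-leaves (suc zero)    = []
  A-leaves (suc (suc x)) = [ [_] , const [] ]′ (splitAt K x)
  B-leaves zero          = []
  B-leaves (suc zero)    = []
  B-leaves (suc (suc x)) = [ const [] , [_] ]′ (splitAt K x)

  ∈-A-leaves : ∀ a → a ∈ A-leaves (leaf (inj₁ a))
  ∈-A-leaves a rewrite Fin.splitAt-↑ˡ K a K = here refl

  ∈-B-leaves : ∀ b → b ∈ B-leaves (leaf (inj₂ b))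
  ∈-B-leaves b rewrite Fin.splitAt-↑ʳ K K b = here refl

  leaves≤weight : ∀ x → length (A-leaves x) ℕ.+ length (B-leaves x) ℕ.≤ weight x
  leaves≤weight zero       = z≤n
  leaves≤weight (suc zero) = z≤n
  leaves≤weight (suc (suc x)) with splitAt K x
  ... | inj₁ _ = ℕ.≤-refl
  ... | inj₂ _ = ℕ.≤-refl

  -- Leaves have weight 1, so the sides of the rectangle add up to at most the total weight that
  -- `visited` bounds by the return time.
  concat-leaves≤weight : ∀ L → length (concatMap A-leaves L) ℕ.+ length (concatMap B-leaves L) ℕ.≤ sum (map weight L)
  concat-leaves≤weight []      = z≤n
  concat-leaves≤weight (x ∷ L) = begin
    length (concatMap A-leaves (x ∷ L)) ℕ.+ length (concatMap B-leaves (x ∷ L))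
      ≡⟨ cong₂ ℕ._+_ (List.length-++ (A-leaves x)) (List.length-++ (B-leaves x)) ⟩
    (length (A-leaves x) ℕ.+ α) ℕ.+ (length (B-leaves x) ℕ.+ β)
      ≡⟨ interchange (length (A-leaves x)) α (length (B-leaves x)) β ⟩
    (length (A-leaves x) ℕ.+ length (B-leaves x)) ℕ.+ (α ℕ.+ β)
      ≤⟨ ℕ.+-mono-≤ (leaves≤weight x) (concat-leaves≤weight L) ⟩
    weight x ℕ.+ sum (map weight L) ∎
    where
    open ℕ.≤-Reasoning
    α β : ℕ
    α = length (concatMap A-leaves L)
    β = length (concatMap B-leaves L)
    interchange : ∀ a b c e → (a ℕ.+ b) ℕ.+ (c ℕ.+ e) ≡ (a ℕ.+ c) ℕ.+ (b ℕ.+ e)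
    interchange = solve-∀

  far-return : ∀ (R : Route star (suc zero)) i t → Route.vertex R i ≡ leaf t →
    ι ((n ℕ.+ n) ℕ.* 2) ≤ Route.returnTime R
  far-return R i t at-t = begin
    ι ((n ℕ.+ n) ℕ.* 2)                          ≡⟨ cong ι (double (n ℕ.+ n)) ⟩
    ι ((n ℕ.+ n) ℕ.+ (n ℕ.+ n))                  ≡⟨ ι-+ (n ℕ.+ n) (n ℕ.+ n) ⟩
    ι (n ℕ.+ n) + ι (n ℕ.+ n)                    ≤⟨ +-mono-≤ far (≤-trans far (≤-reflexive (cong ι (S.dist-sym (suc zero) (leaf t))))) ⟩
    S.d (suc zero) (leaf t) + S.d (leaf t) (suc zero) ≡⟨ cong (λ x → S.d (suc zero) x + S.d x (suc zero)) at-t ⟨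
    S.d (suc zero) (vertex i) + S.d (vertex i) (suc zero) ≤⟨ +-monoˡ-≤ (S.d (vertex i) (suc zero)) (d[depot,v]≤arrive star R i) ⟩
    arrive i + S.d (vertex i) (suc zero)         ≤⟨ arrive+d[v,depot]≤returnTime star R i ⟩
    returnTime                                   ∎
    where
    open ≤-Reasoning
    open Route R
    double : ∀ x → x ℕ.* 2 ≡ x ℕ.+ x
    double = solve-∀
    far : ι (n ℕ.+ n) ≤ S.d (suc zero) (leaf t)
    far = ι-mono-≤ (ℕ.≤-trans (ℕ.n≤1+n (n ℕ.+ n)) (ℕ.m≤m+n (suc (n ℕ.+ n)) 1))

  singleRide : ∀ {route u τ w} (κ : Itinerary star route u τ w) → length (rides star route κ) ℕ.≤ 1 →
    u ≢ w → Σ[ ρ ∈ Ride star route ] Ride.pickupVertex ρ ≡ u × Ride.dropVertex ρ ≡ w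
  singleRide done                          _         u≢w = contradiction refl u≢w
  singleRide (ride ρ at-u _ done)          _         _   = ρ , at-u , refl
  singleRide (ride _ _ _ (ride _ _ _ _)) (s≤s ()) _

  -- With a makespan below 4n, each of the n² central vehicles would serve a rectangle of fewer than
  -- n² pairs and the others would reach no leaf; but the rectangles must cover all n⁴ pairs.
  nonPreemptive-bound : ∀ σ → NonPreemptive star σ → ι ((n ℕ.+ n) ℕ.* 2) ≤ makespan star σ
  nonPreemptive-bound σ nonPreemptive with ι ((n ℕ.+ n) ℕ.* 2) ≤? makespan star σ
  ... | yes 4n≤ = 4n≤
  -- With areas at most K - 1, the covering bound reads K · K ≤ K · (K - 1).
  ... | no  4n≰ = contradiction (rectangles-cover (ℕ.pred K) (X ∘ (_↑ˡ r)) (Y ∘ (_↑ˡ r)) area cover)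
                    (ℕ.<⇒≱ (ℕ.*-monoʳ-< K (ℕ.≤-reflexive (ℕ.suc-pred K))))
    where
    open Schedule σ
    open Route

    seen : ∀ j → Σ[ L ∈ List V ] (∀ i → vertex (route j) i ∈ depot j ∷ L) ×
                                 ι (sum (map weight L) ℕ.* 2) ≤ returnTime (route j) + ι (weight (depot j))
    seen j = visited star (route j) weight (λ x≢y → ≤-reflexive (cong ι (sym (S.dist-≢ x≢y))))

    X Y : Fin (K ℕ.+ r) → List (Fin K)
    X j = concatMap A-leaves (seen j .proj₁)
    Y j = concatMap B-leaves (seen j .proj₁)

    leaf-seen : ∀ j i t → vertex (route j) i ≡ leaf t → leaf t ∈ seen j .proj₁
    -- `visited` lists the vertices only up to the depot, which is not a leaf.
    leaf-seen j i t at-t = tail (λ t≡depot → base≢leaf (splitAt K j) t (sym t≡depot))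
      (subst (_∈ depot j ∷ seen j .proj₁) at-t (seen j .proj₂ .proj₁ i))

    area : ∀ v → length (X (v ↑ˡ r)) ℕ.* length (Y (v ↑ˡ r)) ℕ.≤ ℕ.pred K
    area v = ℕ.<⇒≤pred (ℕ.≰⇒> λ K≤XY → 4n≰ (begin
      ι ((n ℕ.+ n) ℕ.* 2)
        ≤⟨ ι-mono-≤ (ℕ.*-monoˡ-≤ 2 (ℕ.≤-trans (am-gm n (length (X j)) (length (Y j)) K≤XY) (concat-leaves≤weight (seen j .proj₁)))) ⟩
      ι (sum (map weight (seen j .proj₁)) ℕ.* 2) ≤⟨ seen j .proj₂ .proj₂ ⟩
      -- The depot is the centre, of weight 0.
      returnTime (route j) + ι (weight (depot j)) ≡⟨ cong (λ s → returnTime (route j) + ι (weight (base s))) (Fin.splitAt-↑ˡ K v r) ⟩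
      returnTime (route j) + 0ℚ                  ≡⟨ +-identityʳ (returnTime (route j)) ⟩
      returnTime (route j)                       ≤⟨ returnTime≤makespan star σ j ⟩
      makespan star σ                            ∎))
      where
      open ≤-Reasoning
      j : Fin (K ℕ.+ r)
      j = v ↑ˡ r

    far-idle : ∀ j {v} → splitAt K j ≡ inj₂ v → ∀ i t → vertex (route j) i ≢ leaf t
    far-idle j eq i t at-t = 4n≰ (≤-trans (go (route j) (cong base eq) i t at-t) (returnTime≤makespan star σ j))
      where
      -- The depot is made a variable so that its equation with the remote base can be matched.
      go : ∀ {x} (R : Route star x) → x ≡ suc zero → ∀ i t → vertex R i ≡ leaf t →
           ι ((n ℕ.+ n) ℕ.* 2) ≤ returnTime R
      go R refl = far-return R

    -- A single ride puts both leaves on the route of one vehicle, hence the pair into its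
    -- rectangle; a surplus vehicle is excluded because it reaches no leaf.
    byNearVehicle : ∀ {a b} (ρ : Ride star route) s → splitAt K (Ride.vehicle ρ) ≡ s →
      Ride.pickupVertex ρ ≡ leaf (inj₁ a) → Ride.dropVertex ρ ≡ leaf (inj₂ b) →
      Σ[ v ∈ Fin K ] a ∈ X (v ↑ˡ r) × b ∈ Y (v ↑ˡ r)
    byNearVehicle {a} ρ (inj₂ _) eq at-a _ = contradiction at-a (far-idle (Ride.vehicle ρ) eq (Ride.from ρ) (inj₁ a))
    byNearVehicle {a} {b} ρ (inj₁ v) eq at-a at-b =
      v , subst (λ j → a ∈ X j) (sym near) (∈-concatMap⁺ A-leaves (lose (leaf-seen j (Ride.from ρ) (inj₁ a) at-a) (∈-A-leaves a)))
        , subst (λ j → b ∈ Y j) (sym near) (∈-concatMap⁺ B-leaves (lose (leaf-seen j (Ride.to ρ) (inj₂ b) at-b) (∈-B-leaves b)))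
      where
      j : Fin (K ℕ.+ r)
      j = Ride.vehicle ρ
      near : v ↑ˡ r ≡ j
      near = Fin.splitAt⁻¹-↑ˡ eq

    cover : ∀ a b → Σ[ v ∈ Fin K ] a ∈ X (v ↑ˡ r) × b ∈ Y (v ↑ˡ r)
    cover a b =
      let o = combine a b
          ρ , at-s , at-t = singleRide (itinerary o) (nonPreemptive o) (source≢dest o)
      in byNearVehicle ρ _ refl (trans at-s (cong (leaf ∘ inj₁ ∘ proj₁) (Fin.remQuot-combine a b)))
                                (trans at-t (cong (leaf ∘ inj₂ ∘ proj₂) (Fin.remQuot-combine a b)))

  nonPreemptive-optimum : IsOptimalNonPreemptiveMakespan star (ι ((n ℕ.+ n) ℕ.* 2))
  nonPreemptive-optimum =
    (σ , nonPreemptive , ≤-antisym (makespan-schedule (proj₁ ∘ direct)) (nonPreemptive-bound σ nonPreemptive)) ,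
    nonPreemptive-bound
    where
    -- Vehicles are numbered by pairs of a block of A and a block of B; `combine i x` is the leaf x
    -- of block i.
    blocks : Fin n × Fin n → Fin n ⊎ Fin n → Fin K ⊎ Fin K
    blocks (i , _) (inj₁ x) = inj₁ (combine i x)
    blocks (_ , j) (inj₂ y) = inj₂ (combine j y)

    stops : Fin K → Fin (n ℕ.+ n) → Fin K ⊎ Fin K
    stops v l = blocks (remQuot n v) (splitAt n l)

    open Shuttles (n ℕ.+ n) stops

    stops-A : ∀ i j x → stops (combine i j) (x ↑ˡ n) ≡ inj₁ (combine i x)
    stops-A i j x = cong₂ blocks (Fin.remQuot-combine i j) (Fin.splitAt-↑ˡ n x n)

    stops-B : ∀ i j y → stops (combine i j) (n ↑ʳ y) ≡ inj₂ (combine j y)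
    stops-B i j y = cong₂ blocks (Fin.remQuot-combine i j) (Fin.splitAt-↑ʳ n n y)

    -- The first n leaves of a tour lie in A and the other n in B, so every pickup precedes every
    -- delivery and one ride suffices.
    A-before-B : ∀ (x y : Fin n) → toℕ (x ↑ˡ n) ℕ.< toℕ (n ↑ʳ y)
    A-before-B x y = subst₂ ℕ._<_ (sym (Fin.toℕ-↑ˡ x n)) (sym (Fin.toℕ-↑ʳ n y))
      (ℕ.<-≤-trans (Fin.toℕ<n x) (ℕ.m≤m+n n (toℕ y)))

    direct : ∀ o → Σ[ κ ∈ Itinerary star route (source o) 0ℚ (dest o) ] length (rides star route κ) ℕ.≤ 1
    direct o =
      let a , b = remQuot {K} K o
          i , x = remQuot {n} n a
          j , y = remQuot {n} n b
          -- The vehicle that serves the block of a and the block of b.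
          v     = combine i j
          at-a  = trans (tour-stop _ (stops v) (x ↑ˡ n))
                        (cong leaf (trans (stops-A i j x) (cong inj₁ (Fin.combine-remQuot {n} n a))))
          at-b  = trans (tour-stop _ (stops v) (n ↑ʳ y))
                        (cong leaf (trans (stops-B i j y) (cong inj₂ (Fin.combine-remQuot {n} n b))))
      in oneHop v (stop (x ↑ˡ n)) (stop (n ↑ʳ y)) (stop-mono-< (A-before-B x y)) at-a at-b
      where
      oneHop : ∀ {u w} v i k → toℕ i ℕ.< toℕ k → tour _ (stops v) i ≡ u → tour _ (stops v) k ≡ w →
        Σ[ κ ∈ Itinerary star route u 0ℚ w ] length (rides star route κ) ℕ.≤ 1
      oneHop v i k i<k at-u refl = let κ , one = hop v i k i<k at-u (ι-mono-≤ z≤n) done in κ , ℕ.≤-reflexive one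

    σ : Schedule star
    σ = schedule (proj₁ ∘ direct)

    nonPreemptive : NonPreemptive star σ
    nonPreemptive = proj₂ ∘ direct

-- The gap for every q

mainTheorem6 : Σ[ c ∈ ℚ ] 0ℚ < c ×
    ((q : ℕ) → 2 ℕ.≤ q →
    Σ[ I ∈ Instance q ] Uncapacitated I ×
    (Σ[ P ∈ ℚ ] Σ[ N ∈ ℚ ]
    IsOptimalPreemptiveMakespan I P ×
    IsOptimalNonPreemptiveMakespan I N ×
    0ℚ < P ×
    (c * P) √ q ≤ N))
-- The optima have ratio 4n / 4 = n = ⌊√q⌋, and √q < n + 1 ≤ 2n.
mainTheorem6 = ½ , *<* (ℤ.+<+ z<s) , gap
  where
  square : ∀ m → 4 ℕ.* ((m ℕ.+ m) ℕ.* (m ℕ.+ m)) ≡ ((m ℕ.+ m) ℕ.* 2) ℕ.* ((m ℕ.+ m) ℕ.* 2)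
  square = solve-∀

  bound : ∀ m q → q ℕ.≤ (m ℕ.+ m) ℕ.* (m ℕ.+ m) → (½ * ι 4) √ q ≤ ι ((m ℕ.+ m) ℕ.* 2)
  bound m q q≤4m² = ι-mono-≤ z≤n , (begin
    -- The square of ½ · 4 evaluates to 4.
    ι 4 * (ℤ.+ q / 1)                             ≡⟨ cong (ι 4 *_) (ι≡/1 q) ⟨
    ι 4 * ι q                                     ≡⟨ ι-* 4 q ⟨
    ι (4 ℕ.* q)                                   ≤⟨ ι-mono-≤ (ℕ.*-monoʳ-≤ 4 q≤4m²) ⟩
    ι (4 ℕ.* ((m ℕ.+ m) ℕ.* (m ℕ.+ m)))           ≡⟨ cong ι (square m) ⟩
    ι (((m ℕ.+ m) ℕ.* 2) ℕ.* ((m ℕ.+ m) ℕ.* 2))   ≡⟨ ι-* ((m ℕ.+ m) ℕ.* 2) ((m ℕ.+ m) ℕ.* 2) ⟩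
    ι ((m ℕ.+ m) ℕ.* 2) * ι ((m ℕ.+ m) ℕ.* 2)     ∎)
    where open ≤-Reasoning

  gap : (q : ℕ) → 2 ℕ.≤ q → _
  gap q 2≤q with floor-√ q
  ... | zero , _ , q<1 = contradiction (ℕ.<-≤-trans q<1 (ℕ.≤-trans (s≤s z≤n) 2≤q)) (ℕ.<-irrefl refl)
  -- The r = q - n² vehicles left over are the surplus ones.
  ... | n@(suc n-1) , n²≤q , q<[1+n]² with r , refl ← ℕ.m≤n⇒∃[o]m+o≡n n²≤q =
    star , ℕ.≤-refl , ι 4 , ι ((n ℕ.+ n) ℕ.* 2) , preemptive-optimum , nonPreemptive-optimum ,
    *<* (ℤ.+<+ z<s) , bound n q (ℕ.≤-trans (ℕ.<⇒≤ q<[1+n]²) (ℕ.*-mono-≤ 1+n≤n+n 1+n≤n+n))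
    where
    open Gap n r
    1+n≤n+n : suc n ℕ.≤ n ℕ.+ n
    1+n≤n+n = ℕ.+-monoˡ-≤ n (s≤s z≤n)
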